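{- We have the $\mathrm{des}$-Wilf equivalence $\underline{312}4\overset{\mathrm{des}}{\sim}\underline{231}4$.
   Context: $\mathfrak{S}_n$ is the set of permutations of $\{1,\ldots,n\}$ in one-line notation, and $\mathrm{des}(\pi)=|\{i\in[n-1]:\pi_i>\pi_{i+1}\}|$. An occurrence of the pattern $\underline{abc}d$ (where $abcd\in\mathfrak{S}_4$) in $\pi$ is a subsequence $\pi_i\pi_{i+1}\pi_{i+2}\pi_j$ with $j>i+2$ order-isomorphic to $abcd$. $\mathfrak{S}_n(\omega)$ is the set of permutations in $\mathfrak{S}_n$ with no occurrence of $\omega$. $\omega\overset{\mathrm{des}}{\sim}\omega'$ means $|\{\pi\in\mathfrak{S}_n(\omega):\mathrm{des}(\pi)=m\}|=|\{\pi\in\mathfrak{S}_n(\omega'):\mathrm{des}(\pi)=m\}|$ for all $n\ge1$ and $m\ge0$. -}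

module Defs where

open import Data.Fin.Base using (Fin; toℕ)
open import Data.Fin.Properties using (any?; all?)
open import Data.List.Base using (List; [_]; length; filter; map; upTo; allFin; cartesianProductWith)
open import Data.Nat.Base using (ℕ; zero; suc; _<_; _≥_)
open import Data.Nat.Properties using (_≟_; _<?_)
open import Data.Product.Base using (∃-syntax; _×_; _,_)
open import Data.Vec.Base using (Vec; []; _∷_; lookup)
open import Data.Vec.Relation.Unary.AllPairs using (allPairs?)
open import Data.Vec.Relation.Unary.Unique.Propositional using (Unique)
open import Function.Bundles using (_⇔_; mk⇔; module Equivalence)
open import Relation.Binary.PropositionalEquality.Core using (_≡_)
open import Relation.Nullary.Decidable using (Dec; ¬?; _×-dec_; _→-dec_; map′)
open import Relation.Nullary.Negation using (¬_)

-- If `letters` has no repetitions, every word of length k over it is listed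
-- exactly once.
words : List ℕ → (k : ℕ) → List (Vec ℕ k)
words letters zero    = [ [] ]
words letters (suc k) = cartesianProductWith _∷_ letters (words letters k)

unique? : ∀ {k} (w : Vec ℕ k) → Dec (Unique w)
unique? = allPairs? (λ x y → ¬? (x ≟ y))

-- Permutations of {1,…,n} in one-line notation: the words π₁…πₙ over {1,…,n}
-- without repeated letters.  The list itself has no repetitions, so the length
-- of a filtered sublist is the cardinality of the corresponding set.
𝔖 : (n : ℕ) → List (Vec ℕ n)
𝔖 n = filter unique? (words (map suc (upTo n)) n)

-- The last index has no successor i′, so it is never a descent and i effectively
-- ranges over [n-1].
Descent : ∀ {n} → Vec ℕ n → Fin n → Set
Descent π i = ∃[ i′ ] (toℕ i′ ≡ suc (toℕ i) × lookup π i′ < lookup π i)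

descent? : ∀ {n} (π : Vec ℕ n) (i : Fin n) → Dec (Descent π i)
descent? π i = any? λ i′ →
  (toℕ i′ ≟ suc (toℕ i)) ×-dec (lookup π i′ <? lookup π i)

des : ∀ {n} → Vec ℕ n → ℕ
des {n} π = length (filter (descent? π) (allFin n))

OrderIsomorphic : ∀ {k} → Vec ℕ k → Vec ℕ k → Set
OrderIsomorphic u v =
  ∀ x y → (lookup u x < lookup u y) ⇔ (lookup v x < lookup v y)

_⇔-dec_ : ∀ {A B : Set} → Dec A → Dec B → Dec (A ⇔ B)
a? ⇔-dec b? =
  map′ (λ (f , g) → mk⇔ f g) (λ e → Equivalence.to e , Equivalence.from e)
       ((a? →-dec b?) ×-dec (b? →-dec a?))

orderIsomorphic? : ∀ {k} (u v : Vec ℕ k) → Dec (OrderIsomorphic u v)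
orderIsomorphic? u v = all? λ x → all? λ y →
  (lookup u x <? lookup u y) ⇔-dec (lookup v x <? lookup v y)

-- Here and below a word ω = abcd stands for the vincular pattern in which the
-- first three letters abc are underlined, i.e. must be matched by adjacent
-- entries of π.
Occurs : ∀ {n} → Vec ℕ 4 → Vec ℕ n → Set
Occurs ω π = ∃[ i ] ∃[ i′ ] ∃[ i″ ] ∃[ j ]
  ( toℕ i′ ≡ suc (toℕ i)
  × toℕ i″ ≡ suc (toℕ i′)
  × toℕ i″ < toℕ j
  × OrderIsomorphic (lookup π i ∷ lookup π i′ ∷ lookup π i″ ∷ lookup π j ∷ []) ω)

occurs? : ∀ {n} (ω : Vec ℕ 4) (π : Vec ℕ n) → Dec (Occurs ω π)
occurs? ω π = any? λ i → any? λ i′ → any? λ i″ → any? λ j →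
        (toℕ i′ ≟ suc (toℕ i))
  ×-dec (toℕ i″ ≟ suc (toℕ i′))
  ×-dec (toℕ i″ <? toℕ j)
  ×-dec orderIsomorphic?
          (lookup π i ∷ lookup π i′ ∷ lookup π i″ ∷ lookup π j ∷ []) ω

Avoids : ∀ {n} → Vec ℕ 4 → Vec ℕ n → Set
Avoids ω π = ¬ Occurs ω π

avoids? : ∀ {n} (ω : Vec ℕ 4) (π : Vec ℕ n) → Dec (Avoids ω π)
avoids? ω π = ¬? (occurs? ω π)

𝔖-avoiding : Vec ℕ 4 → (n : ℕ) → List (Vec ℕ n)
𝔖-avoiding ω n = filter (avoids? ω) (𝔖 n)

infix 4 _∼des_

_∼des_ : Vec ℕ 4 → Vec ℕ 4 → Set
ω ∼des ω′ = ∀ n m → n ≥ 1 →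
  length (filter (λ π → des π ≟ m) (𝔖-avoiding ω n)) ≡
  length (filter (λ π → des π ≟ m) (𝔖-avoiding ω′ n))

{-# OPTIONS --safe #-}

-- Write π = L n R with n the largest letter.  An occurrence of abc–4 whose abc
-- touches n has no larger letter after it, and one whose abc lies in L can
-- always use n as its 4.  Hence π avoids abc–4 iff L avoids abc as a consecutive
-- pattern and R avoids abc–4.  Reversing L and complementing it within its own
-- set of letters exchanges consecutive 312 with consecutive 231 and preserves
-- descents, so the map Φ (L n R) = rc(L) n Φ(R) is a descent-preserving
-- involution that exchanges the two avoidance classes.

module Submission where

open import Data.Bool.Base using (if_then_else_)
open import Data.Fin.Base as Fin using (Fin; zero; suc; opposite)
open import Data.Fin.Patterns using (0F; 1F; 2F; 3F)
open import Data.Fin.Properties as Fin using (opposite-prop; opposite-involutive; toℕ<n)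
open import Data.List.Base as List
  using (List; []; _∷_; _++_; _ʳ++_; length; filter; map; reverse; upTo; tabulate; break)
open import Data.List.Membership.Propositional using (_∈_)
open import Data.List.Membership.Propositional.Properties
open import Data.List.Membership.Propositional.Properties.WithK using (unique∧set⇒bag)
open import Data.List.Properties
  using (length-map; map-id-local; map-∘; filter-≐; reverse-map; reverse-involutive)
open import Data.List.Relation.Binary.BagAndSetEquality using (∼bag⇒↭)
open import Data.List.Relation.Binary.Permutation.Propositional as ↭
  using (_↭_; ↭-refl; ↭-sym; ↭-trans)
open import Data.List.Relation.Binary.Permutation.Propositional.Properties
  using (All-resp-↭; ∈-resp-↭; ↭-length; ↭-reverse; ++⁺)
import Data.List.Relation.Binary.Permutation.Setoid.Properties as SetoidPerm
open import Data.List.Relation.Unary.All as All using (All; []; _∷_)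
import Data.List.Relation.Unary.All.Properties as All
open import Data.List.Relation.Unary.AllPairs using (AllPairs; []; _∷_)
import Data.List.Relation.Unary.AllPairs.Properties as AllPairs
open import Data.List.Relation.Unary.Any using (here; there; index)
open import Data.List.Relation.Unary.Any.Properties using (lookup-index)
open import Data.List.Relation.Unary.Unique.Propositional using (Unique)
import Data.List.Relation.Unary.Unique.Propositional.Properties as Unique
open import Data.Nat.Base
open import Data.Nat.Properties
open import Data.List.Membership.DecPropositional _≟_ using (_∈?_)
open import Data.Product.Base using (∃-syntax; _×_; _,_; proj₁; proj₂)
open import Data.Sum.Base using (_⊎_; inj₁; inj₂)
open import Data.Vec.Base as Vec using (Vec; []; _∷_; toList; lookup)
import Data.Vec.Membership.Propositional.Properties as VecAny
import Data.Vec.Properties as Vec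
import Data.Vec.Relation.Unary.All.Properties as VecAll
import Data.Vec.Relation.Unary.AllPairs as VecPairs
import Data.Vec.Relation.Unary.Any as VecAny
import Data.Vec.Relation.Unary.Any.Properties as VecAny
import Data.Vec.Relation.Unary.Unique.Propositional as VecUnique
import Data.Vec.Relation.Unary.Unique.Propositional.Properties as VecUnique
open import Function.Base using (_∘_; flip; id)
open import Function.Bundles using (_⇔_; mk⇔; module Equivalence)
open import Relation.Binary.Definitions using (tri<; tri≈; tri>)
open import Relation.Binary.PropositionalEquality
open import Relation.Nullary using (Dec; yes; no; does; ¬_; contradiction)
open import Relation.Nullary.Decidable using (True; toWitness; from-yes; dec-true; dec-false)
open import Relation.Unary using (Pred; Decidable)
open import Defs

private variable
  n : ℕ
  A : Set
  L R S w : List ℕ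

-- Counting repetition-free lists by an involution

unique∧set⇒↭ : {xs ys : List A} → Unique xs → Unique ys →
  (∀ {x} → x ∈ xs ⇔ x ∈ ys) → xs ↭ ys
unique∧set⇒↭ uxs uys same = ∼bag⇒↭ (unique∧set⇒bag uxs uys same)

-- Involutivity is asked only on the members of the two lists, since for `Φ n` it is established
-- only on decomposed words. The two hypotheses give the two inclusions between `map f xs` and `ys`,
-- and repetition-free lists with the same members have the same length.
length-by-involution : (f : A → A) {xs ys : List A} → Unique xs → Unique ys →
  (∀ {x} → x ∈ xs → f x ∈ ys × f (f x) ≡ x) →
  (∀ {y} → y ∈ ys → f y ∈ xs × f (f y) ≡ y) →
  length xs ≡ length ys
length-by-involution f {xs} {ys} uxs uys to from = begin
  length xs         ≡⟨ length-map f xs ⟨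
  length (map f xs) ≡⟨ ↭-length (unique∧set⇒↭ umap uys (mk⇔ fwd bwd)) ⟩
  length ys         ∎
  where
  open ≡-Reasoning
  -- xs ≡ map f (map f xs), and uniqueness of the latter descends to map f xs.
  umap : Unique (map f xs)
  umap = Unique.map⁻ {f = f} (subst Unique
    (trans (sym (map-id-local (All.tabulate (proj₂ ∘ to)))) (map-∘ xs)) uxs)
  fwd : ∀ {y} → y ∈ map f xs → y ∈ ys
  fwd y∈ with x , x∈ , refl ← ∈-map⁻ f y∈ = proj₁ (to x∈)
  bwd : ∀ {y} → y ∈ ys → y ∈ map f xs
  bwd y∈ = subst (_∈ map f xs) (proj₂ (from y∈)) (∈-map⁺ f (proj₁ (from y∈)))

Unique-resp-↭ : {xs ys : List A} → xs ↭ ys → Unique xs → Unique ys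
Unique-resp-↭ p = SetoidPerm.Unique-resp-↭ (setoid _) (↭.↭⇒↭ₛ p)

-- Complementation within a set of letters

lookup-mono-< : AllPairs _<_ S → ∀ {i j} → i Fin.< j → List.lookup S i < List.lookup S j
lookup-mono-< (h ∷ _)  {zero}  {suc j} _         = All.lookup h (∈-lookup j)
lookup-mono-< (_ ∷ hs) {suc i} {suc j} (s≤s i<j) = lookup-mono-< hs i<j

lookup-cancel-< : AllPairs _<_ S → ∀ {i j} → List.lookup S i < List.lookup S j → i Fin.< j
lookup-cancel-< {S} asc {i} {j} lt with Fin.<-cmp i j
... | tri< i<j _ _  = i<j
... | tri≈ _ refl _ = contradiction lt (<-irrefl refl)
... | tri> _ _ j<i  = contradiction lt (<-asym (lookup-mono-< asc j<i))

lookup-injective-< : AllPairs _<_ S → ∀ {i j} → List.lookup S i ≡ List.lookup S j → i ≡ j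
lookup-injective-< {S} asc {i} {j} eq with Fin.<-cmp i j
... | tri< i<j _ _ = contradiction (lookup-mono-< asc i<j) (<-irrefl eq)
... | tri≈ _ i≡j _ = i≡j
... | tri> _ _ j<i = contradiction (lookup-mono-< asc j<i) (<-irrefl (sym eq))

opposite-antimono-< : {i j : Fin n} → i Fin.< j → opposite j Fin.< opposite i
opposite-antimono-< {n} {i} {j} i<j = subst₂ _<_
  (sym (opposite-prop j)) (sym (opposite-prop i)) (∸-monoʳ-< (s≤s i<j) (toℕ<n j))

-- For ascending `S` this exchanges the k-th smallest letter with the k-th largest. Fixing the
-- letters outside `S` makes it an involution of all of ℕ, hence injective.
mirror : List ℕ → ℕ → ℕ
mirror S x with x ∈? S
... | yes x∈S = List.lookup S (opposite (index x∈S))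
... | no  _   = x

module _ (asc : AllPairs _<_ S) where

  mirror-lookup : ∀ i → mirror S (List.lookup S i) ≡ List.lookup S (opposite i)
  mirror-lookup i with List.lookup S i ∈? S
  -- `p` is whichever membership proof the decision procedure returns; its index is `i` because
  -- lookup in a strictly ascending list is injective.
  ... | yes p = cong (List.lookup S ∘ opposite) (lookup-injective-< asc (sym (lookup-index p)))
  ... | no ∉S = contradiction (∈-lookup i) ∉S

  mirror-∈ : ∀ {x} → x ∈ S → mirror S x ∈ S
  mirror-∈ x∈S rewrite lookup-index x∈S | mirror-lookup (index x∈S) = ∈-lookup _

  mirror-involutive : ∀ x → mirror S (mirror S x) ≡ x
  mirror-involutive x with x ∈? S in eq
  ... | yes p = trans (mirror-lookup _)
                 (trans (cong (List.lookup S) (opposite-involutive (index p))) (sym (lookup-index p)))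
  ... | no _ rewrite eq = refl

  mirror-injective : ∀ {x y} → mirror S x ≡ mirror S y → x ≡ y
  mirror-injective {x} {y} eq =
    trans (sym (mirror-involutive x)) (trans (cong (mirror S) eq) (mirror-involutive y))

  mirror-antimono-< : ∀ {x y} → x ∈ S → y ∈ S → x < y → mirror S y < mirror S x
  mirror-antimono-< x∈S y∈S x<y
    rewrite lookup-index x∈S | lookup-index y∈S
          | mirror-lookup (index x∈S) | mirror-lookup (index y∈S) =
    lookup-mono-< asc (opposite-antimono-< (lookup-cancel-< asc x<y))

-- The letters of L (all assumed ≤ n) in increasing order.
values : ℕ → List ℕ → List ℕ
values n L = filter (_∈? L) (upTo (suc n))

values-ascending : ∀ n L → AllPairs _<_ (values n L)
values-ascending n L = AllPairs.filter⁺ (_∈? L) (AllPairs.applyUpTo⁺₁ id (suc n) (λ i<j _ → i<j))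

∈-values⁺ : All (_≤ n) L → ∀ {x} → x ∈ L → x ∈ values n L
∈-values⁺ {L = L} L≤n x∈L = ∈-filter⁺ (_∈? L) (∈-upTo⁺ (s≤s (All.lookup L≤n x∈L))) x∈L

∈-values⁻ : ∀ n L {x} → x ∈ values n L → x ∈ L
∈-values⁻ n L = proj₂ ∘ ∈-filter⁻ (_∈? L) {xs = upTo (suc n)}

-- Filtering `upTo` makes the result depend only on which letters occur. Hence `L` and its reverse
-- complement are mirrored by the same map, and applying `reverseComplement` twice cancels.
values-cong : L ↭ R → values n L ≡ values n R
values-cong {n = n} p =
  filter-≐ (_∈? _) (_∈? _) (∈-resp-↭ p , ∈-resp-↭ (↭-sym p)) (upTo (suc n))

reverseComplement : ℕ → List ℕ → List ℕ
reverseComplement n L = reverse (map (mirror (values n L)) L)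

module _ (L≤n : All (_≤ n) L) where

  private
    V = values n L
    asc = values-ascending n L

  map-mirror-↭ : Unique L → map (mirror V) L ↭ L
  map-mirror-↭ u = unique∧set⇒↭ (Unique.map⁺ (mirror-injective asc) u) u (mk⇔ fwd bwd)
    where
    stable : ∀ {x} → x ∈ L → mirror V x ∈ L
    stable = ∈-values⁻ n L ∘ mirror-∈ asc ∘ ∈-values⁺ L≤n
    fwd : ∀ {y} → y ∈ map (mirror V) L → y ∈ L
    fwd y∈ with x , x∈ , refl ← ∈-map⁻ (mirror V) y∈ = stable x∈
    bwd : ∀ {y} → y ∈ L → y ∈ map (mirror V) L
    bwd {y} y∈ = subst (_∈ map (mirror V) L) (mirror-involutive asc y) (∈-map⁺ _ (stable y∈))

  reverseComplement-↭ : Unique L → reverseComplement n L ↭ L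
  reverseComplement-↭ u = ↭-trans (↭-reverse _) (map-mirror-↭ u)

  reverseComplement-involutive : Unique L →
    reverseComplement n (reverseComplement n L) ≡ L
  reverseComplement-involutive u
    rewrite values-cong {n = n} (reverseComplement-↭ u) = begin
      reverse (map f (reverse (map f L))) ≡⟨ cong reverse (reverse-map f (map f L)) ⟩
      reverse (reverse (map f (map f L))) ≡⟨ reverse-involutive _ ⟩
      map f (map f L)                     ≡⟨ map-∘ L ⟨
      map (f ∘ f) L                       ≡⟨ map-id-local (All.tabulate λ {x} _ → mirror-involutive asc x) ⟩
      L                                   ∎
    where
    open ≡-Reasoning
    f = mirror V

-- Descents of lists

indicator : {P : Set} → Dec P → ℕ
indicator p? = if does p? then 1 else 0

indicator-cong : {P Q : Set} (p? : Dec P) (q? : Dec Q) → P ⇔ Q → indicator p? ≡ indicator q?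
indicator-cong (yes _) (yes _) _ = refl
indicator-cong (no _)  (no _)  _ = refl
indicator-cong (yes p) (no ¬q) e = contradiction (Equivalence.to e p) ¬q
indicator-cong (no ¬p) (yes q) e = contradiction (Equivalence.from e q) ¬p

indicator-yes : {P : Set} (p? : Dec P) → P → indicator p? ≡ 1
indicator-yes (yes _) _ = refl
indicator-yes (no ¬p) p = contradiction p ¬p

indicator-no : {P : Set} (p? : Dec P) → ¬ P → indicator p? ≡ 0
indicator-no (yes p) ¬p = contradiction p ¬p
indicator-no (no _)  _  = refl

adjacentSum : (A → A → ℕ) → List A → ℕ
adjacentSum d []           = 0
adjacentSum d (x ∷ [])     = 0
adjacentSum d (x ∷ y ∷ xs) = d x y + adjacentSum d (y ∷ xs)

-- `x` appears in both summands because it ends the reversed word and immediately precedes `acc`;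
-- thus the pair at the seam is counted exactly once.
adjacentSum-ʳ++ : (d : A → A → ℕ) (x : A) (xs acc : List A) →
  adjacentSum d ((x ∷ xs) ʳ++ acc) ≡ adjacentSum (flip d) (x ∷ xs) + adjacentSum d (x ∷ acc)
adjacentSum-ʳ++ d x []       acc = refl
adjacentSum-ʳ++ d x (y ∷ xs) acc = begin
  adjacentSum d ((y ∷ xs) ʳ++ (x ∷ acc))   ≡⟨ adjacentSum-ʳ++ d y xs (x ∷ acc) ⟩
  s + (d y x + t)                          ≡⟨ +-assoc s (d y x) t ⟨
  s + d y x + t                            ≡⟨ cong (_+ t) (+-comm s (d y x)) ⟩
  d y x + s + t                            ∎
  where
  open ≡-Reasoning
  s = adjacentSum (flip d) (y ∷ xs)
  t = adjacentSum d (x ∷ acc)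

adjacentSum-reverse : (d : A → A → ℕ) (xs : List A) →
  adjacentSum d (reverse xs) ≡ adjacentSum (flip d) xs
adjacentSum-reverse d []       = refl
adjacentSum-reverse d (x ∷ xs) = trans (adjacentSum-ʳ++ d x xs []) (+-identityʳ _)

adjacentSum-map : {d e : A → A → ℕ} {f : A → A} {xs : List A} →
  (∀ {x y} → x ∈ xs → y ∈ xs → d (f x) (f y) ≡ e x y) →
  adjacentSum d (map f xs) ≡ adjacentSum e xs
adjacentSum-map {xs = []}         eq = refl
adjacentSum-map {xs = x ∷ []}     eq = refl
adjacentSum-map {xs = x ∷ y ∷ xs} eq =
  cong₂ _+_ (eq (here refl) (there (here refl))) (adjacentSum-map λ p q → eq (there p) (there q))

descentAt : ℕ → ℕ → ℕ
descentAt x y = indicator (y <? x)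

descents : List ℕ → ℕ
descents = adjacentSum descentAt

-- The step from the last letter of `L` up to `m` is an ascent, so the seam contributes nothing.
descents-++ : ∀ {m} → All (_< m) L → ∀ R → descents (L ++ m ∷ R) ≡ descents L + descents (m ∷ R)
descents-++ [] R = refl
descents-++ {L = x ∷ []} {m} (x<m ∷ []) R = cong (_+ _) (indicator-no (m <? x) (<-asym x<m))
descents-++ {L = x ∷ y ∷ L} (_ ∷ L<m) R =
  trans (cong (descentAt x y +_) (descents-++ L<m R)) (sym (+-assoc (descentAt x y) _ _))

-- The term `1 ⊓ length R` is the descent from `m` into a nonempty `R`. The right side involves `R`
-- only through its length and its number of descents, both of which `Φ` preserves.
descents-max∷ : ∀ {m} → All (_< m) R → descents (m ∷ R) ≡ 1 ⊓ length R + descents R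
descents-max∷ []                   = refl
descents-max∷ {y ∷ R} {m} (y<m ∷ _) = cong (_+ descents (y ∷ R)) (indicator-yes (y <? m) y<m)

-- Reversal swaps the two letters of every adjacent pair and mirroring reverses their comparison;
-- the two effects cancel.
descents-reverseComplement : All (_≤ n) L → descents (reverseComplement n L) ≡ descents L
descents-reverseComplement {n} {L} L≤n =
  trans (adjacentSum-reverse descentAt (map f L)) (adjacentSum-map λ {x} {y} x∈ y∈ →
    indicator-cong (f x <? f y) (y <? x) (mk⇔
      (λ lt → subst₂ _<_ (mirror-involutive asc y) (mirror-involutive asc x)
                (mirror-antimono-< asc (mirror-∈ asc (∈-values⁺ L≤n x∈)) (mirror-∈ asc (∈-values⁺ L≤n y∈)) lt))
      (mirror-antimono-< asc (∈-values⁺ L≤n y∈) (∈-values⁺ L≤n x∈))))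
  where
  asc = values-ascending n L
  f = mirror (values n L)

-- Consecutive and vincular patterns

Pattern : Set₁
Pattern = ℕ → ℕ → ℕ → Set

data Consecutive (T : Pattern) : List ℕ → Set where
  here  : ∀ {a b c s} → T a b c → Consecutive T (a ∷ b ∷ c ∷ s)
  there : ∀ {x s} → Consecutive T s → Consecutive T (x ∷ s)

-- An occurrence of abc-4 with the condition on the final 4 kept apart from `T`. This lets the
-- triple be reversed and complemented on its own and then completed by a different larger letter.
data ConsecutiveThenLarger (T : Pattern) : List ℕ → Set where
  here  : ∀ {a b c d s} → T a b c → a < d → b < d → c < d → d ∈ s →
          ConsecutiveThenLarger T (a ∷ b ∷ c ∷ s)
  there : ∀ {x s} → ConsecutiveThenLarger T s → ConsecutiveThenLarger T (x ∷ s)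

T312 T231 : Pattern
T312 a b c = b < c × c < a
T231 a b c = c < a × a < b

-- The reversed order of arguments reflects reversal of the word, and the antitone `f` reflects
-- complementation. `P` delimits where `f` is antitone; it will be membership in `values n L`.
Dual : Pattern → Pattern → Set₁
Dual T T′ = ∀ {P : ℕ → Set} {f : ℕ → ℕ} →
  (∀ {x y} → P x → P y → x < y → f y < f x) →
  ∀ {a b c} → P a → P b → P c → T a b c → T′ (f c) (f b) (f a)

dual-312-231 : Dual T312 T231
dual-312-231 anti Pa Pb Pc (b<c , c<a) = anti Pc Pa c<a , anti Pb Pc b<c

dual-231-312 : Dual T231 T312
dual-231-312 anti Pa Pb Pc (c<a , a<b) = anti Pa Pb a<b , anti Pc Pa c<a

module _ {T : Pattern} where

  consecutive-ʳ++ : ∀ p {s} → Consecutive T s → Consecutive T (p ʳ++ s)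
  consecutive-ʳ++ []      con = con
  consecutive-ʳ++ (x ∷ p) con = consecutive-ʳ++ p (there con)

  thenLarger-++ʳ : ∀ p {s} → ConsecutiveThenLarger T s → ConsecutiveThenLarger T (p ++ s)
  thenLarger-++ʳ []      occ = occ
  thenLarger-++ʳ (x ∷ p) occ = there (thenLarger-++ʳ p occ)

  consecutive⇒thenLarger : ∀ {m} → All (_< m) L → Consecutive T L → ConsecutiveThenLarger T (L ++ m ∷ R)
  consecutive⇒thenLarger (a<m ∷ b<m ∷ c<m ∷ _) (here {s = s} t) =
    here t a<m b<m c<m (∈-++⁺ʳ s (here refl))
  consecutive⇒thenLarger (_ ∷ L<m) (there con) = there (consecutive⇒thenLarger L<m con)

  thenLarger⇒⊎ : ∀ {m} L → All (_< m) R → ConsecutiveThenLarger T (L ++ m ∷ R) →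
    Consecutive T L ⊎ ConsecutiveThenLarger T R
  -- In the three contradictory clauses `m` is the first, second or third letter of the triple, so
  -- `d` would be a letter of `R` exceeding `m`.
  thenLarger⇒⊎ [] (_ ∷ _ ∷ R<m) (here _ m<d _ _ d∈) = contradiction m<d (<-asym (All.lookup R<m d∈))
  thenLarger⇒⊎ [] R<m (there occ) = inj₂ occ
  thenLarger⇒⊎ (x ∷ []) (_ ∷ R<m) (here _ _ m<d _ d∈) = contradiction m<d (<-asym (All.lookup R<m d∈))
  thenLarger⇒⊎ (x ∷ y ∷ []) R<m (here _ _ _ m<d d∈) = contradiction m<d (<-asym (All.lookup R<m d∈))
  thenLarger⇒⊎ (x ∷ y ∷ z ∷ L) R<m (here t _ _ _ _) = inj₁ (here t)
  thenLarger⇒⊎ (x ∷ L) R<m (there occ) with thenLarger⇒⊎ L R<m occ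
  ... | inj₁ con = inj₁ (there con)
  ... | inj₂ occ′ = inj₂ occ′

consecutive-ʳ++-map : ∀ {T T′ f} {P : ℕ → Set} → All P L →
  (∀ {a b c} → P a → P b → P c → T a b c → T′ (f c) (f b) (f a)) →
  Consecutive T L → ∀ acc → Consecutive T′ (map f L ʳ++ acc)
consecutive-ʳ++-map (Pa ∷ Pb ∷ Pc ∷ _) h (here {s = s} t) acc =
  -- The goal unfolds to `map f s ʳ++ (f c ∷ f b ∷ f a ∷ acc)`, with the reversed image of the
  -- triple at the front of the accumulator.
  consecutive-ʳ++ (map _ s) (here (h Pa Pb Pc t))
consecutive-ʳ++-map (_ ∷ PL) h (there con) acc = consecutive-ʳ++-map PL h con _

consecutive-reverseComplement : ∀ {T T′} → Dual T T′ → All (_≤ n) L →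
  Consecutive T L → Consecutive T′ (reverseComplement n L)
consecutive-reverseComplement {n} {L} dual L≤n con =
  consecutive-ʳ++-map (All.tabulate (∈-values⁺ L≤n))
    (dual (mirror-antimono-< (values-ascending n L))) con []

-- The involution Φ

splice : ℕ → (List ℕ → List ℕ) → List ℕ × List ℕ → List ℕ
splice n φ (L , [])    = φ L
splice n φ (L , m ∷ R) = reverseComplement n L ++ m ∷ φ R

-- The recursion runs on an upper bound for the letters, because `R` need not contain the next
-- smaller value. If `suc n` is absent, `break` returns an empty second part and the bound merely
-- drops by one.
Φ : ℕ → List ℕ → List ℕ
Φ zero    w = w
Φ (suc n) w = splice n (Φ n) (break (_≟ suc n) w)

-- The decomposition w = L n R iterated on R, indexed by an upper bound of the letters.
data Decomposed : ℕ → List ℕ → Set where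
  []   : Decomposed 0 []
  skip : Decomposed n w → Decomposed (suc n) w
  cut  : All (_≤ n) L → Unique L → Decomposed n R → Decomposed (suc n) (L ++ suc n ∷ R)

decomposed-≤ : Decomposed n w → All (_≤ n) w
decomposed-≤ []            = []
decomposed-≤ (skip D)      = All.map m≤n⇒m≤1+n (decomposed-≤ D)
decomposed-≤ (cut L≤n _ D) =
  All.++⁺ (All.map m≤n⇒m≤1+n L≤n) (≤-refl ∷ All.map m≤n⇒m≤1+n (decomposed-≤ D))

decomposed-< : Decomposed n w → All (_< suc n) w
decomposed-< = All.map s≤s ∘ decomposed-≤

unique-++-∷⁻ : ∀ L {m : A} {R} → Unique (L ++ m ∷ R) →
  (All (_≢ m) L × Unique L) × (All (m ≢_) R × Unique R)
unique-++-∷⁻ [] (m∉R ∷ uR) = ([] , []) , m∉R , uR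
unique-++-∷⁻ (x ∷ L) (x∉ ∷ u) with (L≢m , uL) , uR ← unique-++-∷⁻ L u =
  (All.lookup x∉ (∈-++⁺ʳ L (here refl)) ∷ L≢m , All.++⁻ˡ L x∉ ∷ uL) , uR

-- Since `suc n` occurs at most once, the letters on either side of it are at most `n`. The lower
-- bound 1 leaves only the empty word at bound 0.
decompose : ∀ n → Unique w → All (λ x → 1 ≤ x × x ≤ n) w → Decomposed n w
decompose {w = []}    zero u []                  = []
decompose {w = x ∷ w} zero u ((1≤x , x≤0) ∷ _)   = contradiction (≤-trans 1≤x x≤0) λ ()
decompose {w = w} (suc n) u bounds with suc n ∈? w
... | no ∉w = skip (decompose n u (All.tabulate λ x∈ →
        let 1≤x , x≤ = All.lookup bounds x∈ in
        1≤x , ≤-pred (≤∧≢⇒< x≤ λ { refl → ∉w x∈ })))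
... | yes ∈w with L , R , refl ← ∈-∃++ ∈w
             with (L≢m , uL) , (m≢R , uR) ← unique-++-∷⁻ L u =
  cut (All.zipWith (λ { ((_ , x≤) , x≢) → ≤-pred (≤∧≢⇒< x≤ x≢) }) (All.++⁻ˡ L bounds , L≢m)) uL
    (decompose n uR (All.zipWith (λ { ((1≤x , x≤) , m≢x) → 1≤x , ≤-pred (≤∧≢⇒< x≤ (m≢x ∘ sym)) })
      (All.tail (All.++⁻ʳ L bounds) , m≢R)))

break-absent : All (_≤ n) w → break (_≟ suc n) w ≡ (w , [])
break-absent [] = refl
break-absent {n} {x ∷ w} (x≤n ∷ w≤n)
  rewrite dec-false (x ≟ suc n) (<⇒≢ (s≤s x≤n)) | break-absent w≤n = refl

break-cut : All (_≤ n) L → ∀ R → break (_≟ suc n) (L ++ suc n ∷ R) ≡ (L , suc n ∷ R)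
break-cut {n} [] R rewrite dec-true (suc n ≟ suc n) refl = refl
break-cut {n} {x ∷ L} (x≤n ∷ L≤n) R
  rewrite dec-false (x ≟ suc n) (<⇒≢ (s≤s x≤n)) | break-cut L≤n R = refl

Φ-skip : All (_≤ n) w → Φ (suc n) w ≡ Φ n w
Φ-skip {n} w≤n = cong (splice n (Φ n)) (break-absent w≤n)

Φ-cut : All (_≤ n) L → ∀ R → Φ (suc n) (L ++ suc n ∷ R) ≡ reverseComplement n L ++ suc n ∷ Φ n R
Φ-cut {n} L≤n R = cong (splice n (Φ n)) (break-cut L≤n R)

Φ-↭ : Decomposed n w → Φ n w ↭ w
Φ-↭ []       = ↭-refl
Φ-↭ (skip D) rewrite Φ-skip (decomposed-≤ D) = Φ-↭ D
Φ-↭ (cut {R = R} L≤n uL D) rewrite Φ-cut L≤n R =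
  ++⁺ (reverseComplement-↭ L≤n uL) (↭.prep _ (Φ-↭ D))

-- `Φ` permutes the letters on each side of `suc n` separately, so the second application cuts at
-- the same place, or again finds no `suc n`.
Φ-involutive : Decomposed n w → Φ n (Φ n w) ≡ w
Φ-involutive [] = refl
Φ-involutive (skip D)
  rewrite Φ-skip (decomposed-≤ D)
        | Φ-skip (All-resp-↭ (↭-sym (Φ-↭ D)) (decomposed-≤ D)) = Φ-involutive D
Φ-involutive {suc n} (cut {R = R} L≤n uL D)
  rewrite Φ-cut L≤n R
        | Φ-cut (All-resp-↭ (↭-sym (reverseComplement-↭ L≤n uL)) L≤n) (Φ n R) =
  cong₂ (λ L R → L ++ suc n ∷ R) (reverseComplement-involutive L≤n uL) (Φ-involutive D)

descents-Φ : Decomposed n w → descents (Φ n w) ≡ descents w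
descents-Φ [] = refl
descents-Φ (skip D) rewrite Φ-skip (decomposed-≤ D) = descents-Φ D
descents-Φ {suc n} (cut {L = L} {R = R} L≤n uL D) rewrite Φ-cut L≤n R = begin
  descents (L′ ++ suc n ∷ Φ n R)            ≡⟨ descents-++ (All.map s≤s L′≤n) (Φ n R) ⟩
  descents L′ + descents (suc n ∷ Φ n R)    ≡⟨ cong₂ _+_ (descents-reverseComplement L≤n) right ⟩
  descents L + descents (suc n ∷ R)         ≡⟨ descents-++ (All.map s≤s L≤n) R ⟨
  descents (L ++ suc n ∷ R)                 ∎
  where
  open ≡-Reasoning
  L′ = reverseComplement n L
  L′≤n = All-resp-↭ (↭-sym (reverseComplement-↭ L≤n uL)) L≤n
  right : descents (suc n ∷ Φ n R) ≡ descents (suc n ∷ R)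
  right = begin
    descents (suc n ∷ Φ n R)               ≡⟨ descents-max∷ (All-resp-↭ (↭-sym (Φ-↭ D)) (decomposed-< D)) ⟩
    1 ⊓ length (Φ n R) + descents (Φ n R)  ≡⟨ cong₂ (λ k d → 1 ⊓ k + d) (↭-length (Φ-↭ D)) (descents-Φ D) ⟩
    1 ⊓ length R + descents R              ≡⟨ descents-max∷ (decomposed-< D) ⟨
    descents (suc n ∷ R)                   ∎

-- A triple inside `L` becomes a dual triple inside the reverse complement, where `suc n` serves as
-- its larger letter whatever the original one was. Otherwise the whole occurrence lies in `R` and
-- is handled recursively.
Φ-pattern : ∀ {T T′} → Dual T T′ → Decomposed n w →
  ConsecutiveThenLarger T w → ConsecutiveThenLarger T′ (Φ n w)
Φ-pattern dual [] ()
Φ-pattern dual (skip D) occ rewrite Φ-skip (decomposed-≤ D) = Φ-pattern dual D occ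
Φ-pattern {suc n} dual (cut {L = L} {R = R} L≤n uL D) occ
  rewrite Φ-cut L≤n R with thenLarger⇒⊎ L (decomposed-< D) occ
... | inj₁ con  = consecutive⇒thenLarger
        (All-resp-↭ (↭-sym (reverseComplement-↭ L≤n uL)) (All.map s≤s L≤n))
        (consecutive-reverseComplement dual L≤n con)
... | inj₂ occ′ = thenLarger-++ʳ (reverseComplement n L) (there (Φ-pattern dual D occ′))

-- Transfer from vectors to lists

unique-toList⁺ : {v : Vec A n} → VecUnique.Unique v → Unique (toList v)
unique-toList⁺ VecPairs.[]       = []
unique-toList⁺ (p VecPairs.∷ ps) = VecAll.toList⁺ p ∷ unique-toList⁺ ps

unique-toList⁻ : {v : Vec A n} → Unique (toList v) → VecUnique.Unique v
unique-toList⁻ {v = []}    []       = VecPairs.[]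
unique-toList⁻ {v = _ ∷ _} (p ∷ ps) = VecAll.toList⁻ p VecPairs.∷ unique-toList⁻ ps

∈-words⁺ : ∀ {letters k} {v : Vec ℕ k} → All (_∈ letters) (toList v) → v ∈ words letters k
∈-words⁺ {v = []}    []       = here refl
∈-words⁺ {v = _ ∷ _} (p ∷ ps) = ∈-cartesianProductWith⁺ _∷_ p (∈-words⁺ ps)

∈-words⁻ : ∀ letters {k} {v : Vec ℕ k} → v ∈ words letters k → All (_∈ letters) (toList v)
∈-words⁻ letters {zero}  {[]} _ = []
∈-words⁻ letters {suc k} v∈
  with _ , _ , x∈ , u∈ , refl ← ∈-cartesianProductWith⁻ _∷_ letters (words letters k) v∈ =
  x∈ ∷ ∈-words⁻ letters u∈

words-unique : ∀ {letters} → Unique letters → ∀ k → Unique (words letters k)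
words-unique u zero    = [] ∷ []
words-unique u (suc k) = Unique.cartesianProductWith⁺ _∷_ Vec.∷-injective u (words-unique u k)

𝔖-unique : ∀ n → Unique (𝔖 n)
𝔖-unique n = Unique.filter⁺ unique? (words-unique (Unique.map⁺ suc-injective (Unique.upTo⁺ n)) n)

length-filter-∷ : {P : Pred A _} (P? : Decidable P) (x : A) (xs : List A) →
  length (filter P? (x ∷ xs)) ≡ indicator (P? x) + length (filter P? xs)
length-filter-∷ P? x xs with P? x
... | yes _ = refl
... | no _  = refl

length-filter-tabulate : {B : Set} {P : Pred A _} {Q : Pred B _} (P? : Decidable P) (Q? : Decidable Q)
  {f : Fin n → A} {g : Fin n → B} → (∀ i → P (f i) ⇔ Q (g i)) →
  length (filter P? (tabulate f)) ≡ length (filter Q? (tabulate g))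
length-filter-tabulate {n = zero}  P? Q? eq = refl
length-filter-tabulate {n = suc n} P? Q? {f} {g} eq = begin
  length (filter P? (tabulate f))   ≡⟨ length-filter-∷ P? (f zero) (tabulate (f ∘ suc)) ⟩
  indicator (P? (f zero)) + _       ≡⟨ cong₂ _+_ (indicator-cong (P? _) (Q? _) (eq zero))
                                         (length-filter-tabulate P? Q? (eq ∘ suc)) ⟩
  indicator (Q? (g zero)) + _       ≡⟨ length-filter-∷ Q? (g zero) (tabulate (g ∘ suc)) ⟨
  length (filter Q? (tabulate g))   ∎
  where open ≡-Reasoning

descent-suc : ∀ {x} {v : Vec ℕ n} i → Descent (x ∷ v) (suc i) ⇔ Descent v i
descent-suc i = mk⇔
  (λ { (suc i′ , eq , lt) → i′ , suc-injective eq , lt })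
  (λ { (i′ , eq , lt) → suc i′ , cong suc eq , lt })

descent-zero : ∀ {x y} {v : Vec ℕ n} → Descent (x ∷ y ∷ v) zero ⇔ y < x
descent-zero = mk⇔ (λ { (suc zero , _ , lt) → lt }) (λ lt → suc zero , refl , lt)

des-toList : (v : Vec ℕ n) → des v ≡ descents (toList v)
des-toList []      = refl
des-toList (x ∷ []) = trans (length-filter-∷ (descent? (x ∷ [])) zero [])
  (cong (_+ 0) (indicator-no (descent? (x ∷ []) zero) λ { (zero , () , _) }))
des-toList (x ∷ y ∷ v) = begin
  des (x ∷ y ∷ v)  ≡⟨ length-filter-∷ (descent? (x ∷ y ∷ v)) zero (tabulate suc) ⟩
  indicator (descent? (x ∷ y ∷ v) zero) + _
                   ≡⟨ cong₂ _+_ (indicator-cong (descent? (x ∷ y ∷ v) zero) (y <? x) (descent-zero {v = v}))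
                        (trans (length-filter-tabulate (descent? (x ∷ y ∷ v)) (descent? (y ∷ v)) (descent-suc {v = y ∷ v}))
                               (des-toList (y ∷ v))) ⟩
  descentAt x y + descents (toList (y ∷ v)) ∎
  where open ≡-Reasoning

-- Trichotomy on the letters of `v` gives the other implication: equal letters force equal
-- positions, and a pair in the wrong order in `v` would be in the wrong order in `u` too.
orderIsomorphic : ∀ {k} (u v : Vec ℕ k) → VecUnique.Unique v →
  (∀ x y → lookup v x < lookup v y → lookup u x < lookup u y) → OrderIsomorphic u v
orderIsomorphic u v uv mono x y = mk⇔ to (mono x y)
  where
  to : lookup u x < lookup u y → lookup v x < lookup v y
  to lt with <-cmp (lookup v x) (lookup v y)
  ... | tri< vlt _ _ = vlt
  ... | tri≈ _ eq _  with refl ← VecUnique.lookup-injective uv x y eq = contradiction lt (<-irrefl refl)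
  ... | tri> _ _ vgt = contradiction lt (<-asym (mono y x vgt))

-- This is the shape of a pattern whose last letter is its largest: the relative order of the first
-- three letters is `T`, and the fourth exceeds them all.
record Encodes (ω : Vec ℕ 4) (T : Pattern) : Set where
  field
    decode : ∀ {a b c d} → OrderIsomorphic (a ∷ b ∷ c ∷ d ∷ []) ω → T a b c × a < d × b < d × c < d
    encode : ∀ {a b c d} → T a b c → a < d → b < d → c < d → OrderIsomorphic (a ∷ b ∷ c ∷ d ∷ []) ω

open Encodes

ordered : ∀ {k} (u v : Vec ℕ k) → OrderIsomorphic u v → ∀ x y →
  {True (lookup v x <? lookup v y)} → lookup u x < lookup u y
ordered u v iso x y {lt} = Equivalence.from (iso x y) (toWitness lt)

encodes-3124 : Encodes (3 ∷ 1 ∷ 2 ∷ 4 ∷ []) T312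
encodes-3124 .decode {a} {b} {c} {d} iso =
  (lt 1F 2F , lt 2F 0F) , lt 0F 3F , lt 1F 3F , lt 2F 3F
  where
  lt = ordered (a ∷ b ∷ c ∷ d ∷ []) (3 ∷ 1 ∷ 2 ∷ 4 ∷ []) iso
encodes-3124 .encode {a} {b} {c} {d} (b<c , c<a) a<d b<d c<d =
  orderIsomorphic u v (from-yes (unique? v)) mono
  where
  u = a ∷ b ∷ c ∷ d ∷ []
  v = 3 ∷ 1 ∷ 2 ∷ 4 ∷ []
  mono : ∀ x y → lookup v x < lookup v y → lookup u x < lookup u y
  mono 1F 2F _ = b<c
  mono 2F 0F _ = c<a
  mono 1F 0F _ = <-trans b<c c<a
  mono 0F 3F _ = a<d
  mono 1F 3F _ = b<d
  mono 2F 3F _ = c<d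
  mono 0F 0F lt = contradiction lt (<-irrefl refl)
  mono 0F 1F (s≤s ())
  mono 0F 2F (s≤s (s≤s ()))
  mono 1F 1F (s≤s ())
  mono 2F 1F (s≤s ())
  mono 2F 2F (s≤s (s≤s ()))
  mono 3F 0F (s≤s (s≤s (s≤s ())))
  mono 3F 1F (s≤s ())
  mono 3F 2F (s≤s (s≤s ()))
  mono 3F 3F lt = contradiction lt (<-irrefl refl)

encodes-2314 : Encodes (2 ∷ 3 ∷ 1 ∷ 4 ∷ []) T231
encodes-2314 .decode {a} {b} {c} {d} iso =
  (lt 2F 0F , lt 0F 1F) , lt 0F 3F , lt 1F 3F , lt 2F 3F
  where
  lt = ordered (a ∷ b ∷ c ∷ d ∷ []) (2 ∷ 3 ∷ 1 ∷ 4 ∷ []) iso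
encodes-2314 .encode {a} {b} {c} {d} (c<a , a<b) a<d b<d c<d =
  orderIsomorphic u v (from-yes (unique? v)) mono
  where
  u = a ∷ b ∷ c ∷ d ∷ []
  v = 2 ∷ 3 ∷ 1 ∷ 4 ∷ []
  mono : ∀ x y → lookup v x < lookup v y → lookup u x < lookup u y
  mono 2F 0F _ = c<a
  mono 0F 1F _ = a<b
  mono 2F 1F _ = <-trans c<a a<b
  mono 0F 3F _ = a<d
  mono 1F 3F _ = b<d
  mono 2F 3F _ = c<d
  mono 0F 0F (s≤s (s≤s ()))
  mono 0F 2F (s≤s ())
  mono 1F 0F (s≤s (s≤s ()))
  mono 1F 1F lt = contradiction lt (<-irrefl refl)
  mono 1F 2F (s≤s ())
  mono 2F 2F (s≤s ())
  mono 3F 0F (s≤s (s≤s ()))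
  mono 3F 1F (s≤s (s≤s (s≤s ())))
  mono 3F 2F (s≤s ())
  mono 3F 3F lt = contradiction lt (<-irrefl refl)

module _ {ω T} (enc : Encodes ω T) where

  occurs⇒thenLarger : (v : Vec ℕ n) → Occurs ω v → ConsecutiveThenLarger T (toList v)
  occurs⇒thenLarger (x ∷ v) (suc i , suc i′ , suc i″ , suc j , e , e′ , s≤s lt , iso) =
    there (occurs⇒thenLarger v (i , i′ , i″ , j , suc-injective e , suc-injective e′ , lt , iso))
  -- For an occurrence starting at the head, the adjacency equations force positions 0, 1, 2 and the
  -- inequality puts the fourth position in the tail. The clauses after this one refute all other
  -- positions.
  occurs⇒thenLarger (a ∷ b ∷ c ∷ v) (0F , 1F , 2F , suc (suc (suc j)) , _ , _ , _ , iso)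
    with t , a<d , b<d , c<d ← enc .decode iso = here t a<d b<d c<d (VecAny.∈-toList⁺ (VecAny.∈-lookup j v))
  occurs⇒thenLarger (a ∷ b ∷ c ∷ v) (0F , 1F , 2F , 2F , _ , _ , s≤s (s≤s ()) , _)
  occurs⇒thenLarger (a ∷ b ∷ c ∷ v) (0F , 1F , 2F , 1F , _ , _ , s≤s () , _)
  occurs⇒thenLarger (_ ∷ _ ∷ _) (0F , 1F , 1F , _ , _ , () , _)
  occurs⇒thenLarger (_ ∷ _ ∷ _ ∷ _) (0F , 1F , suc (suc (suc _)) , _ , _ , () , _)
  occurs⇒thenLarger (_ ∷ _ ∷ _ ∷ _) (0F , suc (suc _) , _ , _ , () , _)

  thenLarger⇒occurs : (v : Vec ℕ n) → ConsecutiveThenLarger T (toList v) → Occurs ω v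
  thenLarger⇒occurs (a ∷ b ∷ c ∷ v) (here {d = d} t a<d b<d c<d d∈) =
    0F , 1F , 2F , suc (suc (suc j)) , refl , refl , s≤s (s≤s (s≤s z≤n)) ,
    enc .encode t (bound a<d) (bound b<d) (bound c<d)
    where
    j = VecAny.index (VecAny.∈-toList⁻ d∈)
    bound : ∀ {x} → x < d → x < lookup v j
    bound = subst (_ <_) (VecAny.lookup-index (VecAny.∈-toList⁻ d∈))
  thenLarger⇒occurs (x ∷ v) (there occ)
    with i , i′ , i″ , j , e , e′ , lt , iso ← thenLarger⇒occurs v occ =
    suc i , suc i′ , suc i″ , suc j , cong suc e , cong suc e′ , s≤s lt , iso

-- The counted classes as sets of lists, and the action of `Φ` on them

record DescentAvoider (T : Pattern) (n m : ℕ) (w : List ℕ) : Set where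
  field
    length≡   : length w ≡ n
    letters   : All (_∈ map suc (upTo n)) w
    distinct  : Unique w
    avoids    : ¬ ConsecutiveThenLarger T w
    descents≡ : descents w ≡ m

open DescentAvoider

-- The duality runs from `T′` back to `T` because avoidance is contravariant: an occurrence of `T′`
-- in `Φ n w` is carried by a second application of `Φ` to an occurrence of `T` in `w`. For this
-- `Φ n w` needs its own decomposition `D′`.
Φ-avoider : ∀ {T T′ m} → Dual T′ T → DescentAvoider T n m w →
  DescentAvoider T′ n m (Φ n w) × Φ n (Φ n w) ≡ w
Φ-avoider {n} {w} {T} {T′} {m} dual av = av′ , Φ-involutive D
  where
  bound : ∀ {x} → x ∈ map suc (upTo n) → 1 ≤ x × x ≤ n
  bound x∈ with y , y∈ , refl ← ∈-map⁻ suc x∈ = s≤s z≤n , ∈-upTo⁻ y∈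
  D : Decomposed n w
  D = decompose n (av .distinct) (All.map bound (av .letters))
  back = ↭-sym (Φ-↭ D)
  D′ : Decomposed n (Φ n w)
  D′ = decompose n (Unique-resp-↭ back (av .distinct)) (All-resp-↭ back (All.map bound (av .letters)))
  av′ : DescentAvoider T′ n m (Φ n w)
  av′ .length≡   = trans (↭-length (Φ-↭ D)) (av .length≡)
  av′ .letters   = All-resp-↭ back (av .letters)
  av′ .distinct  = Unique-resp-↭ back (av .distinct)
  av′ .avoids occ = av .avoids (subst (ConsecutiveThenLarger T) (Φ-involutive D) (Φ-pattern dual D′ occ))
  av′ .descents≡ = trans (descents-Φ D) (av .descents≡)

asVector : ∀ (w : List A) → length w ≡ n → ∃[ v ] toList {n = n} v ≡ w
asVector w refl = Vec.fromList w , Vec.toList∘fromList w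

avoiders : Vec ℕ 4 → (n m : ℕ) → List (Vec ℕ n)
avoiders ω n m = filter (λ π → des π ≟ m) (𝔖-avoiding ω n)

module _ {ω T} (enc : Encodes ω T) (n m : ℕ) where

  toLists-unique : Unique (map toList (avoiders ω n m))
  toLists-unique = Unique.map⁺ (λ {x} {y} eq → trans (sym (Vec.cast-is-id refl x)) (Vec.toList-injective refl x y eq))
    (Unique.filter⁺ (λ π → des π ≟ m) (Unique.filter⁺ (avoids? ω) (𝔖-unique n)))

  avoiders-sound : ∀ v → v ∈ avoiders ω n m → DescentAvoider T n m (toList v)
  avoiders-sound v v∈ = record
    { length≡   = Vec.length-toList v
    ; letters   = ∈-words⁻ _ (proj₁ v∈words)
    ; distinct  = unique-toList⁺ (proj₂ v∈words)
    ; avoids    = proj₂ v∈𝔖 ∘ thenLarger⇒occurs enc v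
    ; descents≡ = trans (sym (des-toList v)) (proj₂ v∈avoiding)
    }
    where
    v∈avoiding : v ∈ 𝔖-avoiding ω n × des v ≡ m
    v∈avoiding = ∈-filter⁻ (λ π → des π ≟ m) {xs = 𝔖-avoiding ω n} v∈
    v∈𝔖 : v ∈ 𝔖 n × Avoids ω v
    v∈𝔖 = ∈-filter⁻ (avoids? ω) {xs = 𝔖 n} (proj₁ v∈avoiding)
    v∈words : v ∈ words (map suc (upTo n)) n × VecUnique.Unique v
    v∈words = ∈-filter⁻ unique? {xs = words (map suc (upTo n)) n} (proj₁ v∈𝔖)

  ∈-avoiders⁻ : w ∈ map toList (avoiders ω n m) → DescentAvoider T n m w
  ∈-avoiders⁻ w∈ = let v , v∈ , w≡v = ∈-map⁻ toList w∈ in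
    subst (DescentAvoider T n m) (sym w≡v) (avoiders-sound v v∈)

  avoiders-complete : ∀ v → DescentAvoider T n m (toList v) → v ∈ avoiders ω n m
  avoiders-complete v av = ∈-filter⁺ (λ π → des π ≟ m) v∈avoiding (trans (des-toList v) (av .descents≡))
    where
    v∈𝔖 : v ∈ 𝔖 n
    v∈𝔖 = ∈-filter⁺ unique? (∈-words⁺ (av .letters)) (unique-toList⁻ (av .distinct))
    v∈avoiding : v ∈ 𝔖-avoiding ω n
    v∈avoiding = ∈-filter⁺ (avoids? ω) v∈𝔖 (av .avoids ∘ occurs⇒thenLarger enc v)

  ∈-avoiders⁺ : DescentAvoider T n m w → w ∈ map toList (avoiders ω n m)
  ∈-avoiders⁺ {w} av = let v , v≡w = asVector w (length≡ av) in
    subst (_∈ map toList (avoiders ω n m)) v≡w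
      (∈-map⁺ toList (avoiders-complete v (subst (DescentAvoider T n m) (sym v≡w) av)))

theorem3p1 : (3 ∷ 1 ∷ 2 ∷ 4 ∷ []) ∼des (2 ∷ 3 ∷ 1 ∷ 4 ∷ [])
theorem3p1 n m _ = begin
  length (avoiders ω n m)                ≡⟨ length-map toList (avoiders ω n m) ⟨
  length (map toList (avoiders ω n m))   ≡⟨ length-by-involution (Φ n)
                                             (toLists-unique encodes-3124 n m)
                                             (toLists-unique encodes-2314 n m)
                                             (Φ-∈ encodes-3124 encodes-2314 dual-231-312)
                                             (Φ-∈ encodes-2314 encodes-3124 dual-312-231) ⟩
  length (map toList (avoiders ω′ n m))  ≡⟨ length-map toList (avoiders ω′ n m) ⟩
  length (avoiders ω′ n m)               ∎
  where
  open ≡-Reasoning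
  ω ω′ : Vec ℕ 4
  ω  = 3 ∷ 1 ∷ 2 ∷ 4 ∷ []
  ω′ = 2 ∷ 3 ∷ 1 ∷ 4 ∷ []
  Φ-∈ : ∀ {ω ω′ T T′} → Encodes ω T → Encodes ω′ T′ → Dual T′ T →
    ∀ {w} → w ∈ map toList (avoiders ω n m) → Φ n w ∈ map toList (avoiders ω′ n m) × Φ n (Φ n w) ≡ w
  Φ-∈ e e′ dual w∈ =
    let av , inv = Φ-avoider dual (∈-avoiders⁻ e n m w∈) in ∈-avoiders⁺ e′ n m av , inv
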